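{- Let $n\geq 1$ and $\Pi\subseteq\mathfrak{S}_{n}$. Then $$F(\Pi;y,t)=(1+yt)(1+yt^{2})^{n-1}\,P^{(\mathrm{lpk},\mathrm{val},\mathrm{des})}\left(\Pi^{rc};\frac{t(1+y)(y+t)}{(y+t^{2})(1+yt)},\frac{t(1+y)(1+yt)}{(1+yt^{2})(y+t)},\frac{y+t^{2}}{1+yt^{2}}\right).$$
   Context: $\mathfrak{S}_n$ is the set of permutations $\pi=\pi_1\cdots\pi_n$ of $[n]=\{1,\dots,n\}$. For $\pi\in\mathfrak{S}_n$: $\mathrm{des}(\pi)$ is the number of $i\in[n-1]$ with $\pi_i>\pi_{i+1}$; $\mathrm{lpk}(\pi)$ is the number of left peaks, where $i\in[n-1]$ is a left peak if either $2\le i\le n-1$ and $\pi_{i-1}<\pi_i>\pi_{i+1}$, or $i=1$ and $\pi_1>\pi_2$; $\mathrm{val}(\pi)$ is the number of valleys, i.e. of $i$ with $2\le i\le n-1$ and $\pi_{i-1}>\pi_i<\pi_{i+1}$. The reverse complement of $\pi$ is $\pi^{rc}=(n+1-\pi_n)(n+1-\pi_{n-1})\cdots(n+1-\pi_1)$, and $\Pi^{rc}=\{\pi^{rc}\mid\pi\in\Pi\}$ for $\Pi\subseteq\mathfrak{S}_n$. $\mathfrak{B}_n$ is the set of signed permutations: permutations $\sigma$ of $\{ -n,\dots,-1,0,1,\dots,n\}$ with $\sigma_{ -i}=-\sigma_i$ for all $i$ (so $\sigma_0=0$), written $\sigma=\sigma_1\cdots\sigma_n$. For $\sigma\in\mathfrak{B}_n$: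 $\mathrm{des}_B(\sigma)$ is the number of $i\in\{0,1,\dots,n-1\}$ with $\sigma_i>\sigma_{i+1}$ (where $\sigma_0=0$); the flag descent number $\mathrm{fdes}(\sigma)$ is $2\,\mathrm{des}_B(\sigma)$ if $\sigma_1>0$ and $2\,\mathrm{des}_B(\sigma)-1$ if $\sigma_1<0$; $\mathrm{neg}(\sigma)$ is the number of $i\in[n]$ with $\sigma_i<0$. For $\pi\in\mathfrak{S}_n$, $\mathfrak{B}(\pi)\subseteq\mathfrak{B}_n$ is the set of the $2^n$ signed permutations obtained by choosing any subset of the letters of $\pi$ and replacing them with their negatives; for $\Pi\subseteq\mathfrak{S}_n$, $\mathfrak{B}(\Pi)=\bigcup_{\pi\in\Pi}\mathfrak{B}(\pi)$. Define $F(\Pi;y,t)=\sum_{\sigma\in\mathfrak{B}(\Pi)}y^{\mathrm{neg}(\sigma)}t^{\mathrm{fdes}(\sigma)}$ and $P^{(\mathrm{lpk},\mathrm{val},\mathrm{des})}(\Pi;y,z,t)=\sum_{\pi\in\Pi}y^{\mathrm{lpk}(\pi)}z^{\mathrm{val}(\pi)}t^{\mathrm{des}(\pi)}$. The identity is one of rational functions in the indeterminates $y,t$. -}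

module Defs where

open import Algebra.Bundles using (CommutativeRing; RawRing)
open import Algebra.Definitions.RawSemiring using () renaming (_^_ to pow)
import Algebra.Properties.CommutativeSemigroup as CommutativeSemigroupProperties
import Algebra.Properties.Ring as RingProperties
open import Data.Bool.Base using (if_then_else_)
open import Data.Fin.Subset using (Subset; inside; outside)
open import Data.Integer.Base using (ℤ; +_; 0ℤ)
import Data.Integer.Base as ℤ
import Data.Integer.Properties as ℤ
open import Data.List.Base
  using (List; []; _∷_; applyUpTo; cartesianProductWith; concatMap;
         deduplicate; filter; foldr; length)
import Data.List.Base as List
open import Data.List.Relation.Binary.Permutation.Propositional using (_↭_)
open import Data.Nat.Base using (ℕ; zero; suc; pred; _∸_; _≤_; _<_)
import Data.Nat.Base as ℕ
import Data.Nat.Properties as ℕ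
open import Data.Product.Base using (_×_; _,_)
open import Data.Sum.Base using (_⊎_; inj₁; inj₂; [_,_]′)
open import Data.Vec.Base using (Vec; []; _∷_; map; reverse; toList; zipWith)
import Data.Vec.Base as Vec
import Data.Vec.Properties as Vec
open import Function.Base using (_∘_)
open import Level using (0ℓ)
open import Relation.Binary.PropositionalEquality using (_≡_)
open import Relation.Nullary.Decidable
  using (Dec; yes; no; does; False; toWitnessFalse; _×-dec_; _⊎-dec_)
open import Relation.Nullary.Negation using (¬_; contradiction)
open import Relation.Unary using (Pred; Decidable)

------------------------------------------------------------------------
-- Integral domains

record Domain : Set₁ where
  field
    commutativeRing : CommutativeRing 0ℓ 0ℓ
  open CommutativeRing commutativeRing public
  field
    _≟0             : ∀ x → Dec (x ≈ 0#)
    1≉0             : ¬ 1# ≈ 0#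
    noZeroDivisors  : ∀ x y → x * y ≈ 0# → x ≈ 0# ⊎ y ≈ 0#

  *-≉0 : ∀ {x y} → ¬ x ≈ 0# → ¬ y ≈ 0# → ¬ x * y ≈ 0#
  *-≉0 x≉0 y≉0 xy≈0 = [ x≉0 , y≉0 ]′ (noZeroDivisors _ _ xy≈0)

ℤ-domain : Domain
ℤ-domain = record
  { commutativeRing = ℤ.+-*-commutativeRing
  ; _≟0             = ℤ._≟ 0ℤ
  ; 1≉0             = λ ()
  ; noZeroDivisors  = λ x y → ℤ.i*j≡0⇒i≡0∨j≡0 x
  }

------------------------------------------------------------------------
-- Polynomials in one indeterminate over an integral domain

module Polynomials (D : Domain) where

  private
    module R = Domain D
    module R+ = CommutativeSemigroupProperties R.+-commutativeSemigroup
    module R- = RingProperties R.ring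

  -- Coefficients in order of increasing degree, trailing zeros allowed.
  Poly : Set
  Poly = List R.Carrier

  coeff : Poly → ℕ → R.Carrier
  coeff []      _       = R.0#
  coeff (a ∷ p) zero    = a
  coeff (a ∷ p) (suc i) = coeff p i

  infix 4 _≈_
  record _≈_ (p q : Poly) : Set where
    constructor mk≈
    field
      coeff-≈ : ∀ i → coeff p i R.≈ coeff q i
  open _≈_ public

  infix  8 -_
  infixl 7 _*_ _·_
  infixl 6 _+_

  _+_ : Poly → Poly → Poly
  []      + q       = q
  (a ∷ p) + []      = a ∷ p
  (a ∷ p) + (b ∷ q) = (a R.+ b) ∷ (p + q)

  -_ : Poly → Poly
  - p = List.map R.-_ p

  _·_ : R.Carrier → Poly → Poly
  a · p = List.map (a R.*_) p

  _*_ : Poly → Poly → Poly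
  []      * q = []
  (a ∷ p) * q = a · q + (R.0# ∷ p * q)

  const : R.Carrier → Poly
  const a = a ∷ []

  -- The indeterminate.
  X : Poly
  X = R.0# ∷ R.1# ∷ []

  private
    ≈-refl : ∀ {p} → p ≈ p
    ≈-refl = mk≈ λ i → R.refl

    ≈-sym : ∀ {p q} → p ≈ q → q ≈ p
    ≈-sym e = mk≈ λ i → R.sym (coeff-≈ e i)

    ≈-trans : ∀ {p q r} → p ≈ q → q ≈ r → p ≈ r
    ≈-trans e f = mk≈ λ i → R.trans (coeff-≈ e i) (coeff-≈ f i)

    ∷-cong : ∀ {a b p q} → a R.≈ b → p ≈ q → a ∷ p ≈ b ∷ q
    ∷-cong a≈b p≈q = mk≈ λ { zero → a≈b ; (suc i) → coeff-≈ p≈q i }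

    ∷-≈0 : ∀ {a p} → a R.≈ R.0# → p ≈ [] → a ∷ p ≈ []
    ∷-≈0 a≈0 p≈0 = mk≈ λ { zero → a≈0 ; (suc i) → coeff-≈ p≈0 i }

    tail-≈0 : ∀ {a p} → a ∷ p ≈ [] → p ≈ []
    tail-≈0 e = mk≈ (coeff-≈ e ∘ suc)

    coeff-+ : ∀ p q i → coeff (p + q) i R.≈ coeff p i R.+ coeff q i
    coeff-+ []      q       i       = R.sym (R.+-identityˡ _)
    coeff-+ (a ∷ p) []      i       = R.sym (R.+-identityʳ _)
    coeff-+ (a ∷ p) (b ∷ q) zero    = R.refl
    coeff-+ (a ∷ p) (b ∷ q) (suc i) = coeff-+ p q i

    coeff-neg : ∀ p i → coeff (- p) i R.≈ R.- coeff p i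
    coeff-neg []      i       = R.sym R-.-0#≈0#
    coeff-neg (a ∷ p) zero    = R.refl
    coeff-neg (a ∷ p) (suc i) = coeff-neg p i

    coeff-· : ∀ a p i → coeff (a · p) i R.≈ a R.* coeff p i
    coeff-· a []      i       = R.sym (R.zeroʳ a)
    coeff-· a (b ∷ p) zero    = R.refl
    coeff-· a (b ∷ p) (suc i) = coeff-· a p i

    +-cong : ∀ {p p′ q q′} → p ≈ p′ → q ≈ q′ → p + q ≈ p′ + q′
    +-cong {p} {p′} {q} {q′} e f = mk≈ λ i →
      R.trans (coeff-+ p q i)
        (R.trans (R.+-cong (coeff-≈ e i) (coeff-≈ f i))
          (R.sym (coeff-+ p′ q′ i)))

    +-comm : ∀ p q → p + q ≈ q + p
    +-comm p q = mk≈ λ i →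
      R.trans (coeff-+ p q i)
        (R.trans (R.+-comm _ _) (R.sym (coeff-+ q p i)))

    +-assoc : ∀ p q r → (p + q) + r ≈ p + (q + r)
    +-assoc p q r = mk≈ λ i →
      R.trans (coeff-+ (p + q) r i)
        (R.trans (R.+-congʳ (coeff-+ p q i))
          (R.trans (R.+-assoc _ _ _)
            (R.sym (R.trans (coeff-+ p (q + r) i)
                            (R.+-congˡ (coeff-+ q r i))))))

    +-identityʳ : ∀ p → p + [] ≈ p
    +-identityʳ p = +-comm p []

    +-interchange : ∀ p q r s → (p + q) + (r + s) ≈ (p + r) + (q + s)
    +-interchange p q r s = mk≈ λ i →
      R.trans (split p q r s i)
        (R.trans (R+.interchange _ _ _ _) (R.sym (split p r q s i)))
      where
      split : ∀ p q r s i → coeff ((p + q) + (r + s)) i R.≈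
              (coeff p i R.+ coeff q i) R.+ (coeff r i R.+ coeff s i)
      split p q r s i = R.trans (coeff-+ (p + q) (r + s) i)
                          (R.+-cong (coeff-+ p q i) (coeff-+ r s i))

    neg-cong : ∀ {p q} → p ≈ q → - p ≈ - q
    neg-cong {p} {q} e = mk≈ λ i →
      R.trans (coeff-neg p i)
        (R.trans (R.-‿cong (coeff-≈ e i)) (R.sym (coeff-neg q i)))

    +-inverseʳ : ∀ p → p + (- p) ≈ []
    +-inverseʳ p = mk≈ λ i →
      R.trans (coeff-+ p (- p) i)
        (R.trans (R.+-congˡ (coeff-neg p i)) (R.-‿inverseʳ _))

    ·-cong : ∀ {a b p q} → a R.≈ b → p ≈ q → a · p ≈ b · q
    ·-cong {a} {b} {p} {q} e f = mk≈ λ i →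
      R.trans (coeff-· a p i)
        (R.trans (R.*-cong e (coeff-≈ f i)) (R.sym (coeff-· b q i)))

    ·-zeroˡ : ∀ {a} → a R.≈ R.0# → ∀ p → a · p ≈ []
    ·-zeroˡ {a} a≈0 p = mk≈ λ i →
      R.trans (coeff-· a p i) (R.trans (R.*-congʳ a≈0) (R.zeroˡ _))

    ·-identity : ∀ p → R.1# · p ≈ p
    ·-identity p = mk≈ λ i → R.trans (coeff-· R.1# p i) (R.*-identityˡ _)

    ·-assoc : ∀ a b p → a · (b · p) ≈ (a R.* b) · p
    ·-assoc a b p = mk≈ λ i →
      R.trans (coeff-· a (b · p) i)
        (R.trans (R.*-congˡ (coeff-· b p i))
          (R.trans (R.sym (R.*-assoc _ _ _))
            (R.sym (coeff-· (a R.* b) p i))))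

    ·-distrib-+ : ∀ a p q → a · (p + q) ≈ a · p + a · q
    ·-distrib-+ a p q = mk≈ λ i →
      R.trans (coeff-· a (p + q) i)
        (R.trans (R.*-congˡ (coeff-+ p q i))
          (R.trans (R.distribˡ _ _ _)
            (R.sym (R.trans (coeff-+ (a · p) (a · q) i)
                     (R.+-cong (coeff-· a p i) (coeff-· a q i))))))

    *-zeroʳ : ∀ p → p * [] ≈ []
    *-zeroʳ []      = ≈-refl
    *-zeroʳ (a ∷ p) = ∷-≈0 R.refl (*-zeroʳ p)

    *-congˡ : ∀ p {q r} → q ≈ r → p * q ≈ p * r
    *-congˡ []      e = ≈-refl
    *-congˡ (a ∷ p) e =
      +-cong (·-cong R.refl e) (∷-cong R.refl (*-congˡ p e))

    *-∷ : ∀ q a p → q * (a ∷ p) ≈ a · q + (R.0# ∷ q * p)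
    *-∷ []      a p = ≈-sym (∷-≈0 R.refl ≈-refl)
    *-∷ (b ∷ q) a p = ∷-cong (R.+-congʳ (R.*-comm b a))
      (≈-trans (+-cong ≈-refl (*-∷ q a p))
        (≈-trans (≈-sym (+-assoc (b · p) (a · q) _))
          (≈-trans (+-cong (+-comm (b · p) (a · q)) ≈-refl)
            (+-assoc (a · q) (b · p) _))))

    *-comm : ∀ p q → p * q ≈ q * p
    *-comm []      q = ≈-sym (*-zeroʳ q)
    *-comm (a ∷ p) q =
      ≈-trans (+-cong (≈-refl {a · q}) (∷-cong R.refl (*-comm p q)))
              (≈-sym (*-∷ q a p))

    *-cong : ∀ {p p′ q q′} → p ≈ p′ → q ≈ q′ → p * q ≈ p′ * q′
    *-cong {p} {p′} {q} {q′} e f =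
      ≈-trans (*-congˡ p f)
        (≈-trans (*-comm p q′) (≈-trans (*-congˡ q′ e) (*-comm q′ p′)))

    *-distribˡ : ∀ p q r → p * (q + r) ≈ p * q + p * r
    *-distribˡ []      q r = ≈-refl
    *-distribˡ (a ∷ p) q r =
      ≈-trans (+-cong (·-distrib-+ a q r)
                (∷-cong (R.sym (R.+-identityˡ _)) (*-distribˡ p q r)))
              (+-interchange (a · q) (a · r) (R.0# ∷ p * q) (R.0# ∷ p * r))

    *-distribʳ : ∀ p q r → (q + r) * p ≈ q * p + r * p
    *-distribʳ p q r =
      ≈-trans (*-comm (q + r) p)
        (≈-trans (*-distribˡ p q r) (+-cong (*-comm p q) (*-comm p r)))

    0∷-* : ∀ {a} → a R.≈ R.0# → ∀ p q → (a ∷ p) * q ≈ R.0# ∷ p * q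
    0∷-* a≈0 p q = +-cong (·-zeroˡ a≈0 q) ≈-refl

    ·-*-assoc : ∀ a q r → (a · q) * r ≈ a · (q * r)
    ·-*-assoc a []      r = ≈-refl
    ·-*-assoc a (b ∷ q) r =
      ≈-trans (+-cong (≈-sym (·-assoc a b r))
                (∷-cong (R.sym (R.zeroʳ a)) (·-*-assoc a q r)))
              (≈-sym (·-distrib-+ a (b · r) (R.0# ∷ q * r)))

    *-assoc : ∀ p q r → (p * q) * r ≈ p * (q * r)
    *-assoc []      q r = ≈-refl
    *-assoc (a ∷ p) q r =
      ≈-trans (*-distribʳ r (a · q) (R.0# ∷ p * q))
        (+-cong (·-*-assoc a q r)
          (≈-trans (0∷-* R.refl (p * q) r) (∷-cong R.refl (*-assoc p q r))))

    *-identityˡ : ∀ p → const R.1# * p ≈ p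
    *-identityˡ p =
      ≈-trans (+-cong (·-identity p) (∷-≈0 R.refl ≈-refl)) (+-identityʳ p)

    _≟0 : ∀ p → Dec (p ≈ [])
    []      ≟0 = yes ≈-refl
    (a ∷ p) ≟0 with a R.≟0 | p ≟0
    ... | yes a≈0 | yes p≈0 = yes (∷-≈0 a≈0 p≈0)
    ... | no  a≉0 | _       = no λ e → a≉0 (coeff-≈ e 0)
    ... | yes _   | no p≉0  = no λ e → p≉0 (tail-≈0 e)

    noZeroDivisors : ∀ p q → p * q ≈ [] → p ≈ [] ⊎ q ≈ []
    noZeroDivisors []      q pq≈0 = inj₁ ≈-refl
    noZeroDivisors (a ∷ p) q pq≈0 with a R.≟0
    ... | yes a≈0 = [ inj₁ ∘ ∷-≈0 a≈0 , inj₂ ]′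
      (noZeroDivisors p q
        (tail-≈0 (≈-trans (≈-sym (0∷-* a≈0 p q)) pq≈0)))
    ... | no  a≉0 = inj₂ (cancel q pq≈0)
      where
      cancel : ∀ q → (a ∷ p) * q ≈ [] → q ≈ []
      cancel []      e = ≈-refl
      cancel (b ∷ q) e = ∷-≈0 b≈0 (cancel q (≈-trans (*-comm (a ∷ p) q)
        (tail-≈0 (≈-trans (≈-sym (0∷-* b≈0 q (a ∷ p)))
                   (≈-trans (*-comm (b ∷ q) (a ∷ p)) e)))))
        where
        b≈0 : b R.≈ R.0#
        b≈0 = [ (λ a≈0 → contradiction a≈0 a≉0) , (λ b≈0 → b≈0) ]′
          (R.noZeroDivisors a b
            (R.trans (R.sym (R.+-identityʳ _)) (coeff-≈ e 0)))

  domain : Domain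
  domain = record
    { commutativeRing = record
      { Carrier           = Poly
      ; _≈_               = _≈_
      ; _+_               = _+_
      ; _*_               = _*_
      ; -_                = -_
      ; 0#                = []
      ; 1#                = const R.1#
      ; isCommutativeRing = record
        { isRing = record
          { +-isAbelianGroup = record
            { isGroup = record
              { isMonoid = record
                { isSemigroup = record
                  { isMagma = record
                    { isEquivalence = record
                      { refl = ≈-refl ; sym = ≈-sym ; trans = ≈-trans }
                    ; ∙-cong = +-cong
                    }
                  ; assoc = +-assoc
                  }
                ; identity = (λ _ → ≈-refl) , +-identityʳ
                }
              ; inverse = (λ p → ≈-trans (+-comm (- p) p) (+-inverseʳ p))
                        , +-inverseʳ
              ; ⁻¹-cong = neg-cong
              }
            ; comm = +-comm
            }
          ; *-cong     = *-cong
          ; *-assoc    = *-assoc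
          ; *-identity = *-identityˡ
                       , λ p → ≈-trans (*-comm p _) (*-identityˡ p)
          ; distrib    = *-distribˡ , *-distribʳ
          }
        ; *-comm = *-comm
        }
      }
    ; _≟0            = _≟0
    ; 1≉0            = λ e → R.1≉0 (coeff-≈ e 0)
    ; noZeroDivisors = noZeroDivisors
    }

------------------------------------------------------------------------
-- The field of fractions of an integral domain

module Fractions (D : Domain) where

  private
    module D = Domain D

  record Fraction : Set where
    constructor fraction
    field
      num   : D.Carrier
      den   : D.Carrier
      den≉0 : ¬ den D.≈ D.0#
  open Fraction public

  ι : D.Carrier → Fraction
  ι a = fraction a D.1# D.1≉0

  infix 4 _≃_
  data _≃_ (u v : Fraction) : Set where
    *≈* : num u D.* den v D.≈ num v D.* den u → u ≃ v

  private
    add mul : Fraction → Fraction → Fraction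
    add u v = fraction (num u D.* den v D.+ num v D.* den u)
                       (den u D.* den v) (D.*-≉0 (den≉0 u) (den≉0 v))
    mul u v = fraction (num u D.* num v)
                       (den u D.* den v) (D.*-≉0 (den≉0 u) (den≉0 v))

  rawRing : RawRing 0ℓ 0ℓ
  rawRing = record
    { Carrier = Fraction
    ; _≈_     = _≃_
    ; _+_     = add
    ; _*_     = mul
    ; -_      = λ u → fraction (D.- num u) (den u) (den≉0 u)
    ; 0#      = ι D.0#
    ; 1#      = ι D.1#
    }

  -- The implicit proof that the divisor is nonzero is found by computation
  -- when the divisor is closed.
  infixl 7 _÷_
  _÷_ : (u v : Fraction) → {False (num v D.≟0)} → Fraction
  _÷_ u v {v≉0} = fraction (num u D.* den v) (den u D.* num v)
                           (D.*-≉0 (den≉0 u) (toWitnessFalse v≉0))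

------------------------------------------------------------------------
-- Rational functions in the indeterminates y and t

module ℤ[y]    = Polynomials ℤ-domain
module ℤ[y][t] = Polynomials ℤ[y].domain

-- Clearing denominators, the fraction field of ℤ[y,t] is ℚ(y,t).
module K = Fractions ℤ[y][t].domain

open K public using (_÷_)
open RawRing K.rawRing public
  using (_≈_; _+_; _*_; 0#; 1#; rawSemiring) renaming (Carrier to ℚ⟨y,t⟩)

infixr 8 _^_
_^_ : ℚ⟨y,t⟩ → ℕ → ℚ⟨y,t⟩
_^_ = pow rawSemiring

y t : ℚ⟨y,t⟩
y = K.ι (ℤ[y][t].const ℤ[y].X)
t = K.ι ℤ[y][t].X

∑ : {A : Set} → List A → (A → ℚ⟨y,t⟩) → ℚ⟨y,t⟩
∑ xs f = foldr _+_ 0# (List.map f xs)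

infix 5 ∑
syntax ∑ xs (λ x → e) = ∑[ x ∈ xs ] e

------------------------------------------------------------------------
-- Words and their statistics

private
  variable
    A : Set
    n : ℕ

-- letter a w i is the letter at position i of a w₁ … wₙ, so that w keeps its
-- usual positions 1, …, n and a sits at position 0.  Beyond n the last letter
-- is repeated.
letter : A → Vec A n → ℕ → A
letter a w       zero    = a
letter a []      (suc i) = a
letter a (b ∷ w) (suc i) = letter b w i

-- a, a + 1, …, b ∸ 1
range : ℕ → ℕ → List ℕ
range a b = applyUpTo (a ℕ.+_) (b ∸ a)

count : {P : Pred ℕ 0ℓ} → Decidable P → List ℕ → ℕ
count P? is = length (filter P? is)

module _ (π : Vec ℕ n) where

  private
    at : ℕ → ℕ
    at = letter 0 π

  Descent LeftPeak Valley : Pred ℕ 0ℓ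
  Descent  i = at (suc i) < at i
  LeftPeak i = (2 ≤ i × at (pred i) < at i × at (suc i) < at i)
             ⊎ (i ≡ 1 × at 2 < at 1)
  Valley   i = at i < at (pred i) × at i < at (suc i)

  descent? : Decidable Descent
  descent? i = at (suc i) ℕ.<? at i

  leftPeak? : Decidable LeftPeak
  leftPeak? i =
    (2 ℕ.≤? i ×-dec at (pred i) ℕ.<? at i ×-dec at (suc i) ℕ.<? at i)
    ⊎-dec (i ℕ.≟ 1 ×-dec at 2 ℕ.<? at 1)

  valley? : Decidable Valley
  valley? i = at i ℕ.<? at (pred i) ×-dec at i ℕ.<? at (suc i)

  des lpk val : ℕ
  des = count descent? (range 1 n)
  lpk = count leftPeak? (range 1 n)
  val = count valley? (range 2 n)

module _ (σ : Vec ℤ n) where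

  private
    at : ℕ → ℤ
    at = letter 0ℤ σ

  Descentᴮ : Pred ℕ 0ℓ
  Descentᴮ i = at (suc i) ℤ.< at i

  descentᴮ? : Decidable Descentᴮ
  descentᴮ? i = at (suc i) ℤ.<? at i

  desᴮ fdes neg : ℕ
  desᴮ = count descentᴮ? (range 0 n)
  fdes = if does (0ℤ ℤ.<? at 1) then 2 ℕ.* desᴮ else 2 ℕ.* desᴮ ∸ 1
  neg  = Vec.count (ℤ._<? 0ℤ) σ

------------------------------------------------------------------------
-- Permutations and signed permutations, in one-line notation

IsPermutation : Vec ℕ n → Set
IsPermutation {n} π = toList π ↭ range 1 (suc n)

rc : Vec ℕ n → Vec ℕ n
rc {n} π = reverse (map (λ a → suc n ∸ a) π)

subsets : ∀ n → List (Subset n)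
subsets zero    = [] ∷ []
subsets (suc n) = cartesianProductWith _∷_ (outside ∷ inside ∷ []) (subsets n)

negateAt : Subset n → Vec ℕ n → Vec ℤ n
negateAt = zipWith λ s a → if s then ℤ.- (+ a) else + a

-- A signed permutation σ is determined by σ₁ … σₙ, since σ₀ = 0 and
-- σ₋ᵢ = - σᵢ; each S gives a different one, as the letters of π are nonzero.
𝔅 : Vec ℕ n → List (Vec ℤ n)
𝔅 {n} π = List.map (λ S → negateAt S π) (subsets n)

-- Finite sets are lists without repetition; deduplication turns the list of
-- values into the image, respectively the concatenation into the union.

_^rc : List (Vec ℕ n) → List (Vec ℕ n)
Π ^rc = deduplicate (Vec.≡-dec ℕ._≟_) (List.map rc Π)

𝔅[_] : List (Vec ℕ n) → List (Vec ℤ n)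
𝔅[ Π ] = deduplicate (Vec.≡-dec ℤ._≟_) (concatMap 𝔅 Π)

F : List (Vec ℕ n) → ℚ⟨y,t⟩ → ℚ⟨y,t⟩ → ℚ⟨y,t⟩
F Π y t = ∑[ σ ∈ 𝔅[ Π ] ] y ^ neg σ * t ^ fdes σ

P : List (Vec ℕ n) → ℚ⟨y,t⟩ → ℚ⟨y,t⟩ → ℚ⟨y,t⟩ → ℚ⟨y,t⟩
P Π y z t = ∑[ π ∈ Π ] y ^ lpk π * z ^ val π * t ^ des π

{-# OPTIONS --safe #-}
module Submission where

-- Choosing the signs of π independently, each comparison of adjacent letters is
-- decided by the sign of the larger one.  Hence the sum over 𝔅(π) is a product
-- over the letters of π, a letter contributing t²(1 + y), 1 + y, 1 + y t² or
-- y + t² according as it is a peak, a valley, a double ascent or a double descent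
-- (with π₀ = 0, πₙ₊₁ = ∞ and a modified factor for π₁).  Reverse complementation
-- exchanges peaks and valleys, and since these alternate along π the product
-- is the monomial on the right-hand side.

open import Defs hiding (_≈_; _+_; _*_; 0#; 1#; _^_; _÷_; y; t; ∑)
open import Algebra.Bundles using (CommutativeSemiring; RawRing)
open import Algebra.Definitions using (AlmostRightCancellative)
import Algebra.Properties.Group as GroupProperties
import Algebra.Properties.Ring as RingProperties
import Algebra.Properties.Semiring.Exp as Exponentiation
import Algebra.Solver.Ring.NaturalCoefficients.Default as NaturalSolver
open import Algebra.Structures.Biased using (isCommutativeMonoidˡ; isCommutativeSemiringˡ)
open import Data.Bool.Base using (Bool; true; false; not; _∧_; _∨_; if_then_else_)
open import Data.Bool.Properties using (∧-comm; ∧-identityʳ; ∧-zeroʳ; ∨-identityʳ)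
open import Data.Fin.Subset using (Subset)
open import Data.Integer.Base as ℤ using (ℤ; +_; 0ℤ)
import Data.Integer.Properties as ℤ
open import Data.List.Base as List
  using (List; []; _∷_; _++_; applyUpTo; concatMap; deduplicate; filter; foldr)
open import Data.List.Membership.Propositional.Properties using (∈-map⁻)
import Data.List.Properties as List
open import Data.List.Relation.Binary.Disjoint.Propositional using (Disjoint)
open import Data.List.Relation.Binary.Permutation.Propositional using (↭-sym; ↭⇒↭ₛ)
open import Data.List.Relation.Binary.Permutation.Propositional.Properties using (All-resp-↭)
open import Data.List.Relation.Binary.Permutation.Setoid.Properties using (Unique-resp-↭)
open import Data.List.Relation.Unary.All as All using (All; []; _∷_)
import Data.List.Relation.Unary.All.Properties as All
open import Data.List.Relation.Unary.AllPairs as AllPairs using ([]; _∷_)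
import Data.List.Relation.Unary.AllPairs.Properties as AllPairs
open import Data.List.Relation.Unary.Unique.Propositional using (Unique)
import Data.List.Relation.Unary.Unique.Propositional.Properties as Unique
open import Data.Nat.Base as ℕ using (ℕ; zero; suc; _≤_; _<_; _∸_; s≤s; z<s; s<s)
import Data.Nat.Properties as ℕ
open import Data.Product.Base using (_,_)
open import Data.Sum.Base using (inj₁; inj₂; [_,_]′)
open import Data.Vec.Base as Vec using (Vec; []; _∷_; _∷ʳ_; toList; reverse)
import Data.Vec.Properties as Vec
open import Function.Base using (_∘_; id)
open import Function.Bundles using (mk⇔)
open import Level using (0ℓ)
open import Relation.Binary.Definitions using (DecidableEquality)
open import Relation.Binary.PropositionalEquality as ≡ using (_≡_; _≢_)
open import Relation.Binary.Structures using (IsEquivalence)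
open import Relation.Nullary.Decidable using (False; does; does-⇔; dec-false; toWitnessFalse; ¬?)
open import Relation.Nullary.Negation using (¬_; contradiction)
open import Relation.Unary using (Pred; Decidable)

-- Write Y, Z, T for the three arguments on the right-hand side and A, ..., E for the polynomials
-- named in `SignedWords`. A peak contributes t²C and a valley C, but the right-hand side assigns
-- them ZE and DY. These agree only in product, since YZ·ED = t²C², so a letter-by-letter comparison
-- fails: a pending factor has to be carried from each peak to the valley ending its run of
-- descents. The convention πₙ₊₁ = ∞ guarantees that this valley exists. Y itself is fixed by words
-- that start with a descent: their first letter contributes t² + yt = tB instead of A, and their
-- first valley has no peak before it. Equating tB·C with AT·DY, where TD = E, gives Y = tCB/(EA),
-- and the product then gives Z.

-- Arithmetic of fractions over an integral domain

module FractionProperties (D : Domain) where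

  open Domain D
  open Fractions D
  open NaturalSolver commutativeSemiring
  open import Relation.Binary.Reasoning.Setoid setoid

  *-almostCancelʳ : AlmostRightCancellative _≈_ 0# _*_
  *-almostCancelʳ c a b c≉0 ac≈bc =
    GroupProperties.x∙y⁻¹≈ε⇒x≈y +-group a b
      ([ id , (λ c≈0 → contradiction c≈0 c≉0) ]′ (noZeroDivisors (a - b) c (begin
        (a - b) * c    ≈⟨ RingProperties.[y-z]x≈yx-zx ring c a b ⟩
        a * c - b * c  ≈⟨ +-congʳ ac≈bc ⟩
        b * c - b * c  ≈⟨ -‿inverseʳ (b * c) ⟩
        0#             ∎)))

  ≃-isEquivalence : IsEquivalence _≃_
  ≃-isEquivalence = record
    { refl  = *≈* refl
    ; sym   = λ { (*≈* e) → *≈* (sym e) }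
    ; trans = ≃-trans
    }
    where
    ≃-trans : ∀ {u v w} → u ≃ v → v ≃ w → u ≃ w
    ≃-trans {fraction a b _} {fraction c d d≉0} {fraction e f _} (*≈* ad≈cb) (*≈* cf≈ed) =
      -- Chaining the two cross-multiplied equations leaves the middle denominator `d` as a common
      -- factor; cancelling it uses the absence of zero divisors.
      *≈* (*-almostCancelʳ d _ _ d≉0 (begin
        a * f * d    ≈⟨ solve 3 (λ a f d → a :* f :* d := a :* d :* f) refl a f d ⟩
        a * d * f    ≈⟨ *-congʳ ad≈cb ⟩
        c * b * f    ≈⟨ solve 3 (λ c b f → c :* b :* f := c :* f :* b) refl c b f ⟩
        c * f * b    ≈⟨ *-congʳ cf≈ed ⟩
        e * d * b    ≈⟨ solve 3 (λ e d b → e :* d :* b := e :* b :* d) refl e d b ⟩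
        e * b * d    ∎))

  private
    module Fr = RawRing (Fractions.rawRing D)

  +-cong-≃ : ∀ {u u′ v v′} → u ≃ u′ → v ≃ v′ → (u Fr.+ v) ≃ (u′ Fr.+ v′)
  +-cong-≃ {fraction a b _} {fraction a′ b′ _} {fraction c d _} {fraction c′ d′ _} (*≈* e) (*≈* f) =
    *≈* (begin
      (a * d + c * b) * (b′ * d′)
        ≈⟨ solve 6 (λ a b c d b′ d′ →
               (a :* d :+ c :* b) :* (b′ :* d′) := a :* b′ :* (d :* d′) :+ c :* d′ :* (b :* b′))
             refl a b c d b′ d′ ⟩
      a * b′ * (d * d′) + c * d′ * (b * b′)
        ≈⟨ +-cong (*-congʳ e) (*-congʳ f) ⟩
      a′ * b * (d * d′) + c′ * d * (b * b′)
        ≈⟨ solve 6 (λ a′ b c′ d b′ d′ →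
               a′ :* b :* (d :* d′) :+ c′ :* d :* (b :* b′) := (a′ :* d′ :+ c′ :* b′) :* (b :* d))
             refl a′ b c′ d b′ d′ ⟩
      (a′ * d′ + c′ * b′) * (b * d) ∎)

  *-cong-≃ : ∀ {u u′ v v′} → u ≃ u′ → v ≃ v′ → (u Fr.* v) ≃ (u′ Fr.* v′)
  *-cong-≃ {fraction a b _} {fraction a′ b′ _} {fraction c d _} {fraction c′ d′ _} (*≈* e) (*≈* f) =
    *≈* (begin
      a * c * (b′ * d′)
        ≈⟨ solve 4 (λ a c b′ d′ → a :* c :* (b′ :* d′) := a :* b′ :* (c :* d′)) refl a c b′ d′ ⟩
      a * b′ * (c * d′)
        ≈⟨ *-cong e f ⟩
      a′ * b * (c′ * d)
        ≈⟨ solve 4 (λ a′ b c′ d → a′ :* b :* (c′ :* d) := a′ :* c′ :* (b :* d)) refl a′ b c′ d ⟩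
      a′ * c′ * (b * d) ∎)

  -- The sums involve no negation, and division enters through `÷-*` and cancellation, so a semiring
  -- is enough structure for the whole computation.
  commutativeSemiring-≃ : CommutativeSemiring 0ℓ 0ℓ
  commutativeSemiring-≃ = record
    { Carrier = Fraction
    ; _≈_     = _≃_
    ; _+_     = Fr._+_
    ; _*_     = Fr._*_
    ; 0#      = Fr.0#
    ; 1#      = Fr.1#
    ; isCommutativeSemiring = isCommutativeSemiringˡ record
      { +-isCommutativeMonoid = isCommutativeMonoidˡ record
        { isSemigroup = record
          { isMagma = record { isEquivalence = ≃-isEquivalence ; ∙-cong = +-cong-≃ }
          ; assoc = λ { (fraction a b _) (fraction c d _) (fraction e f _) → *≈* (solve 6 (λ a b c d e f →
              ((a :* d :+ c :* b) :* f :+ e :* (b :* d)) :* (b :* (d :* f)) :=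
              (a :* (d :* f) :+ (c :* f :+ e :* d) :* b) :* (b :* d :* f)) refl a b c d e f) }
          }
        ; identityˡ = λ { (fraction a b _) → *≈* (solve 2 (λ a b →
            (con 0 :* b :+ a :* con 1) :* b := a :* (con 1 :* b)) refl a b) }
        ; comm = λ { (fraction a b _) (fraction c d _) → *≈* (solve 4 (λ a b c d →
            (a :* d :+ c :* b) :* (d :* b) := (c :* b :+ a :* d) :* (b :* d)) refl a b c d) }
        }
      ; *-isCommutativeMonoid = isCommutativeMonoidˡ record
        { isSemigroup = record
          { isMagma = record { isEquivalence = ≃-isEquivalence ; ∙-cong = *-cong-≃ }
          ; assoc = λ { (fraction a b _) (fraction c d _) (fraction e f _) → *≈* (solve 6 (λ a b c d e f →
              a :* c :* e :* (b :* (d :* f)) := a :* (c :* e) :* (b :* d :* f)) refl a b c d e f) }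
          }
        ; identityˡ = λ { (fraction a b _) → *≈* (solve 2 (λ a b →
            con 1 :* a :* b := a :* (con 1 :* b)) refl a b) }
        ; comm = λ { (fraction a b _) (fraction c d _) → *≈* (solve 4 (λ a b c d →
            a :* c :* (d :* b) := c :* a :* (b :* d)) refl a b c d) }
        }
      ; distribʳ = λ { (fraction a b _) (fraction c d _) (fraction e f _) → *≈* (solve 6 (λ a b c d e f →
          (c :* f :+ e :* d) :* a :* (d :* b :* (f :* b)) :=
          (c :* a :* (f :* b) :+ e :* a :* (d :* b)) :* (d :* f :* b)) refl a b c d e f) }
      ; zeroˡ = λ { (fraction a b _) → *≈* (solve 2 (λ a b →
          con 0 :* a :* con 1 := con 0 :* (con 1 :* b)) refl a b) }
      }
    }

  ÷-* : ∀ u v {v≉0 : False (num v ≟0)} → ((u ÷ v) {v≉0} Fr.* v) ≃ u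
  ÷-* (fraction a b _) (fraction c d _) = *≈*
    (solve 4 (λ a b c d → a :* d :* c :* b := a :* (b :* c :* d)) refl a b c d)

  *-cancelʳ-≃ : ∀ {u v} w → ¬ num w ≈ 0# → (u Fr.* w) ≃ (v Fr.* w) → u ≃ v
  *-cancelʳ-≃ {fraction a b _} {fraction c d _} (fraction e f f≉0) e≉0 (*≈* p) =
    *≈* (*-almostCancelʳ (e * f) _ _ (*-≉0 e≉0 f≉0) (begin
      a * d * (e * f)    ≈⟨ solve 4 (λ a d e f → a :* d :* (e :* f) := a :* e :* (d :* f)) refl a d e f ⟩
      a * e * (d * f)    ≈⟨ p ⟩
      c * e * (b * f)    ≈⟨ solve 4 (λ c b e f → c :* e :* (b :* f) := c :* b :* (e :* f)) refl c b e f ⟩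
      c * b * (e * f)    ∎))

  -- Extracts nonvanishing factors from the nonzero divisors of the given quotients.
  num-*ʳ-≉0 : ∀ u v → ¬ num (u Fr.* v) ≈ 0# → ¬ num v ≈ 0#
  num-*ʳ-≉0 u v uv≉0 v≈0 = uv≉0 (trans (*-congˡ v≈0) (zeroʳ (num u)))

  num-*-≉0 : ∀ u v → ¬ num u ≈ 0# → ¬ num v ≈ 0# → ¬ num (u Fr.* v) ≈ 0#
  num-*-≉0 u v = *-≉0

-- Counting along a Boolean sequence

sucIf : Bool → ℕ → ℕ
sucIf b k = if b then suc k else k

-- Recursion on the length, with a shifted sequence, peels off positions in step with the letters of
-- a word, which filtering a list of positions does not.
tally : (ℕ → Bool) → ℕ → ℕ
tally p zero    = 0
tally p (suc m) = sucIf (p 0) (tally (p ∘ suc) m)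

count-applyUpTo : {P : Pred ℕ 0ℓ} (P? : Decidable P) (f : ℕ → ℕ) (m : ℕ) →
                  count P? (applyUpTo f m) ≡ tally (λ i → does (P? (f i))) m
count-applyUpTo P? f zero    = ≡.refl
count-applyUpTo P? f (suc m) with does (P? (f 0))
... | true  = ≡.cong suc (count-applyUpTo P? (f ∘ suc) m)
... | false = count-applyUpTo P? (f ∘ suc) m

tally-cong : ∀ {p q} m → (∀ i → i < m → p i ≡ q i) → tally p m ≡ tally q m
tally-cong zero    e = ≡.refl
tally-cong (suc m) e = ≡.cong₂ sucIf (e 0 z<s) (tally-cong m λ i i<m → e (suc i) (s<s i<m))

tally-last : ∀ p m → tally p (suc m) ≡ sucIf (p m) (tally p m)
tally-last p zero    = ≡.refl
tally-last p (suc m) = ≡.trans (≡.cong (sucIf (p 0)) (tally-last (p ∘ suc) m))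
                             (sucIf-comm (p 0) (p (suc m)))
  where
  sucIf-comm : ∀ b c {k} → sucIf b (sucIf c k) ≡ sucIf c (sucIf b k)
  sucIf-comm false c     = ≡.refl
  sucIf-comm true  false = ≡.refl
  sucIf-comm true  true  = ≡.refl

tally-reverse : ∀ p m → tally (λ i → p (m ∸ suc i)) m ≡ tally p m
tally-reverse p zero    = ≡.refl
tally-reverse p (suc m) = ≡.trans (≡.cong (sucIf (p m)) (tally-reverse p m)) (≡.sym (tally-last p m))

-- Letters of a word

module _ {A : Set} where

  letter-∷ʳ-< : ∀ {n} (z : A) (w : Vec A n) x i → i ≤ n → letter z (w ∷ʳ x) i ≡ letter z w i
  letter-∷ʳ-< z w       x zero    _         = ≡.refl
  letter-∷ʳ-< z (b ∷ w) x (suc i) (s≤s i≤n) = letter-∷ʳ-< b w x i i≤n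

  letter-∷ʳ-last : ∀ {n} (z : A) (w : Vec A n) x → letter z (w ∷ʳ x) (suc n) ≡ x
  letter-∷ʳ-last z []      x = ≡.refl
  letter-∷ʳ-last z (b ∷ w) x = letter-∷ʳ-last b w x

  letter-beyond : ∀ {n} (z : A) (w : Vec A n) → letter z w (suc n) ≡ letter z w n
  letter-beyond z []      = ≡.refl
  letter-beyond z (b ∷ w) = letter-beyond b w

  -- Both positions lie between 1 and n, so the letters at position 0 are never reached. They are
  -- kept separate because the recursion replaces only the right one.
  letter-reverse : ∀ {n} (z z′ : A) (w : Vec A n) i → i < n →
                   letter z (reverse w) (suc i) ≡ letter z′ w (n ∸ i)
  letter-reverse {suc n} z z′ (x ∷ w) i (s≤s i≤n)
    rewrite Vec.reverse-∷ x w with ℕ.m≤n⇒m<n∨m≡n i≤n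
  ... | inj₁ i<n rewrite ℕ.+-∸-assoc 1 i≤n =
    ≡.trans (letter-∷ʳ-< z (reverse w) x (suc i) i<n) (letter-reverse z x w i i<n)
  ... | inj₂ ≡.refl rewrite ℕ.m+n∸n≡m 1 i = letter-∷ʳ-last z (reverse w) x

  letter-All : ∀ {P : A → Set} {n} {z} {w : Vec A n} → P z → All P (toList w) → ∀ i → P (letter z w i)
  letter-All             pz pw        zero    = pz
  letter-All {w = []}    pz []        (suc i) = pz
  letter-All {w = _ ∷ _} pz (pb ∷ pw) (suc i) = letter-All pb pw i

  letter-Unique : ∀ {n} z (w : Vec A n) → Unique (z ∷ toList w) →
                  ∀ i → i < n → letter z w i ≢ letter z w (suc i)
  letter-Unique z (b ∷ w) ((z≢b ∷ _) ∷ _) zero    _         = z≢b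
  letter-Unique z (b ∷ w) (_ ∷ u)         (suc i) (s≤s i<n) = letter-Unique b w u i i<n

letter-map : ∀ {A B : Set} {n} (f : A → B) z (w : Vec A n) i →
             letter (f z) (Vec.map f w) i ≡ f (letter z w i)
letter-map f z w       zero    = ≡.refl
letter-map f z []      (suc i) = ≡.refl
letter-map f z (b ∷ w) (suc i) = letter-map f b w i

-- Statistics of the reverse complement

-- As `d i` compares positions i and i + 1, term i concerns the letter at position i + 1.
valleys peaks : (ℕ → Bool) → ℕ → Bool
valleys d i = d i ∧ not (d (suc i))
peaks   d i = not (d i) ∧ d (suc i)

-- Since letter repeats the last letter, term n of the sequence is false: the
-- convention πₙ₊₁ = ∞.
descents : ∀ {n} → ℕ → Vec ℕ n → ℕ → Bool
descents a w i = does (letter a w (suc i) ℕ.<? letter a w i)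

descents-last : ∀ {n} a (w : Vec ℕ n) → descents a w n ≡ false
descents-last {n} a w = dec-false (_ ℕ.<? _) (ℕ.<-irrefl (letter-beyond a w))

module _ {m a} {w : Vec ℕ m}
         (unique : Unique (a ∷ toList w)) (bounded : All (_≤ suc m) (a ∷ toList w)) where

  private
    N = suc (suc m)
    d = descents a w

    -- Both sequences start at index 0, with n = m + 1 letters, so that index i is mirrored to m -
    -- i.
    e c : ℕ → ℕ
    e = letter a w
    c i = letter 0 (rc (a ∷ w)) (suc i)

    e≤N : ∀ i → e i ≤ N
    e≤N = letter-All (ℕ.m≤n⇒m≤1+n (All.head bounded)) (All.map ℕ.m≤n⇒m≤1+n (All.tail bounded))

    c≡N∸e : ∀ i → i ≤ m → c i ≡ N ∸ e (m ∸ i)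
    c≡N∸e i i≤m = begin
      letter 0 (reverse v) (suc i)      ≡⟨ letter-reverse 0 0 v i (s≤s i≤m) ⟩
      letter 0 v (suc m ∸ i)            ≡⟨ ≡.cong (letter 0 v) (ℕ.+-∸-assoc 1 i≤m) ⟩
      letter (N ∸ a) (Vec.map (N ∸_) w) (m ∸ i)  ≡⟨ letter-map (N ∸_) a w (m ∸ i) ⟩
      N ∸ e (m ∸ i)                     ∎
      where
      open ≡.≡-Reasoning
      v = Vec.map (N ∸_) (a ∷ w)

    complement-<? : ∀ i j → does (N ∸ e i ℕ.<? N ∸ e j) ≡ does (e j ℕ.<? e i)
    complement-<? i j =
      does-⇔ (mk⇔ ℕ.∸-cancelʳ-< (λ ej<ei → ℕ.∸-monoʳ-< ej<ei (e≤N i))) (_ ℕ.<? _) (_ ℕ.<? _)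

    module _ (i : ℕ) (i<m : i < m) where

      c-suc : c (suc i) ≡ N ∸ e (m ∸ suc i)
      c-suc = c≡N∸e (suc i) i<m

      c-this : c i ≡ N ∸ e (suc (m ∸ suc i))
      c-this = ≡.trans (c≡N∸e i (ℕ.<⇒≤ i<m)) (≡.cong (λ j → N ∸ e j) (ℕ.+-∸-assoc 1 i<m))

      -- Reversal and complementation each invert the comparison, so together they only mirror the
      -- position.
      rc-descent : does (c (suc i) ℕ.<? c i) ≡ d (m ∸ suc i)
      rc-descent rewrite c-suc | c-this = complement-<? (m ∸ suc i) (suc (m ∸ suc i))

      -- Neighbouring letters differ, which makes ascents exactly the non-descents.
      rc-ascent : does (c i ℕ.<? c (suc i)) ≡ not (d (m ∸ suc i))
      rc-ascent rewrite c-suc | c-this =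
        ≡.trans (complement-<? (suc (m ∸ suc i)) (m ∸ suc i))
          (does-⇔ (mk⇔ ℕ.<⇒≯ (λ ≯ → ℕ.≤∧≢⇒< (ℕ.≮⇒≥ ≯)
                     (letter-Unique a w unique (m ∸ suc i) (ℕ.∸-monoʳ-< z<s i<m))))
            (_ ℕ.<? _) (¬? (_ ℕ.<? _)))

  des-rc : des (rc (a ∷ w)) ≡ tally d (suc m)
  des-rc = begin
    des (rc (a ∷ w))                      ≡⟨ count-applyUpTo (descent? (rc (a ∷ w))) suc m ⟩
    tally (λ i → does (c (suc i) ℕ.<? c i)) m  ≡⟨ tally-cong m rc-descent ⟩
    tally (λ i → d (m ∸ suc i)) m         ≡⟨ tally-reverse d m ⟩
    -- The false term `d m` is added so that splitting off `d 0` later leaves m terms, as in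
    -- `statistics`.
    tally d m                             ≡⟨ ≡.cong (λ b → sucIf b (tally d m)) (descents-last a w) ⟨
    sucIf (d m) (tally d m)               ≡⟨ tally-last d m ⟨
    tally d (suc m)                       ∎
    where open ≡.≡-Reasoning

  lpk-rc : lpk (rc (a ∷ w)) ≡ tally (valleys d) m
  lpk-rc = begin
    lpk (rc (a ∷ w))                      ≡⟨ count-applyUpTo (leftPeak? (rc (a ∷ w))) suc m ⟩
    tally (λ i → does (leftPeak? (rc (a ∷ w)) (suc i))) m  ≡⟨ tally-cong m pointwise ⟩
    tally (λ i → p (m ∸ suc i)) m         ≡⟨ tally-reverse p m ⟩
    tally p m                             ∎
    where
    open ≡.≡-Reasoning
    p : ℕ → Bool
    p = valleys d
    pointwise : ∀ i → i < m → does (leftPeak? (rc (a ∷ w)) (suc i)) ≡ p (m ∸ suc i)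
    -- A left peak at position 1 comes from a last letter preceded by a descent, which is a valley
    -- of π because πₙ₊₁ = ∞.
    pointwise zero 0<m = begin
      does (c 1 ℕ.<? c 0)                 ≡⟨ rc-descent 0 0<m ⟩
      d (m ∸ 1)                           ≡⟨ ∧-identityʳ _ ⟨
      d (m ∸ 1) ∧ true                    ≡⟨ ≡.cong (λ b → d (m ∸ 1) ∧ not b) (descents-last a w) ⟨
      d (m ∸ 1) ∧ not (d m)               ≡⟨ ≡.cong (λ j → d (m ∸ 1) ∧ not (d j)) (ℕ.+-∸-assoc 1 0<m) ⟩
      p (m ∸ 1)                           ∎
    pointwise (suc i) i<m = begin
      (does (c i ℕ.<? c (suc i)) ∧ does (c (suc (suc i)) ℕ.<? c (suc i))) ∨ false
        ≡⟨ ∨-identityʳ _ ⟩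
      does (c i ℕ.<? c (suc i)) ∧ does (c (suc (suc i)) ℕ.<? c (suc i))
        ≡⟨ ≡.cong₂ _∧_ (rc-ascent i (ℕ.<⇒≤ i<m)) (rc-descent (suc i) i<m) ⟩
      not (d (m ∸ suc i)) ∧ d (m ∸ suc (suc i))
        ≡⟨ ∧-comm (not (d (m ∸ suc i))) _ ⟩
      d (m ∸ suc (suc i)) ∧ not (d (m ∸ suc i))
        ≡⟨ ≡.cong (λ j → d (m ∸ suc (suc i)) ∧ not (d j)) (ℕ.+-∸-assoc 1 i<m) ⟩
      p (m ∸ suc (suc i)) ∎

  val-rc : val (rc (a ∷ w)) ≡ tally (peaks d) m
  val-rc = ≡.trans (count-applyUpTo (valley? (rc (a ∷ w))) (λ i → suc (suc i)) (m ∸ 1))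
                 (truncated m ≡.refl)
    where
    open ≡.≡-Reasoning
    p : ℕ → Bool
    p = peaks d
    -- Positions 2 to n - 1 give `m ∸ 1` terms. The copy `k` of the module parameter `m` permits a
    -- case distinction.
    truncated : ∀ k → k ≡ m → tally (λ i → does (valley? (rc (a ∷ w)) (suc (suc i)))) (k ∸ 1) ≡ tally p k
    truncated zero    k≡m  = ≡.refl
    truncated (suc k) ≡.refl = begin
      tally (λ i → does (valley? (rc (a ∷ w)) (suc (suc i)))) k  ≡⟨ tally-cong k pointwise ⟩
      tally (λ i → p (k ∸ suc i)) k       ≡⟨ tally-reverse p k ⟩
      -- The missing term `p k` is false: the last letter of π is never a peak, since πₙ₊₁ = ∞.
      tally p k                           ≡⟨ ≡.cong (λ b → sucIf b (tally p k)) (∧-zeroʳ _) ⟨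
      sucIf (not (d k) ∧ false) (tally p k)
        ≡⟨ ≡.cong (λ b → sucIf (not (d k) ∧ b) (tally p k)) (descents-last a w) ⟨
      sucIf (p k) (tally p k)             ≡⟨ tally-last p k ⟨
      tally p (suc k)                     ∎
      where
      pointwise : ∀ i → i < k → does (valley? (rc (a ∷ w)) (suc (suc i))) ≡ p (k ∸ suc i)
      pointwise i i<k = begin
        does (c (suc i) ℕ.<? c i) ∧ does (c (suc i) ℕ.<? c (suc (suc i)))
          ≡⟨ ≡.cong₂ _∧_ (rc-descent i (ℕ.m≤n⇒m≤1+n i<k)) (rc-ascent (suc i) (s<s i<k)) ⟩
        d (k ∸ i) ∧ not (d (k ∸ suc i))
          ≡⟨ ∧-comm (d (k ∸ i)) _ ⟩
        not (d (k ∸ suc i)) ∧ d (k ∸ i)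
          ≡⟨ ≡.cong (λ j → not (d (k ∸ suc i)) ∧ d j) (ℕ.+-∸-assoc 1 i<k) ⟩
        p (k ∸ suc i) ∎

-- Comparison of signed letters

signed : Bool → ℕ → ℤ
signed s a = if s then ℤ.- (+ a) else + a

signed-<? : ∀ {a b} s s′ → 0 < a → 0 < b → a ≢ b →
            does (signed s′ b ℤ.<? signed s a) ≡ (if does (b ℕ.<? a) then not s else s′)
signed-<? {suc a} {suc b} false false _ _ _   with does (suc b ℕ.<? suc a)
... | true  = ≡.refl
... | false = ≡.refl
signed-<? {suc a} {suc b} false true  _ _ _   with does (suc b ℕ.<? suc a)
... | true  = ≡.refl
... | false = ≡.refl
signed-<? {suc a} {suc b} true  false _ _ _   with does (suc b ℕ.<? suc a)
... | true  = ≡.refl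
... | false = ≡.refl
-- Two negative signs reverse the order of absolute values, so `a≢b` must turn a failed strict
-- inequality into the opposite strict one.
signed-<? {suc a} {suc b} true  true  _ _ a≢b =
  ≡.trans
    (does-⇔ (mk⇔ (ℕ.<⇒≯ ∘ s<s) λ ≯ → ℕ.s<s⁻¹ (ℕ.≤∧≢⇒< (ℕ.≮⇒≥ ≯) a≢b))
      (a ℕ.<? b) (¬? (suc b ℕ.<? suc a)))
    (if-not (does (suc b ℕ.<? suc a)))
  where
  if-not : ∀ c → not c ≡ (if c then false else true)
  if-not false = ≡.refl
  if-not true  = ≡.refl

descentsᴮ : ∀ {n} → ℤ → Vec ℤ n → ℕ → Bool
descentsᴮ z τ i = does (letter z τ (suc i) ℤ.<? letter z τ i)

-- Permutations and the absence of repetitions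

module _ {n} (π : Vec ℕ n) (π↭ : IsPermutation π) where

  permutation-positive : All (0 <_) (toList π)
  permutation-positive = All-resp-↭ (↭-sym π↭) (All.applyUpTo⁺₂ suc n (λ _ → z<s))

  permutation-bounded : All (_≤ n) (toList π)
  permutation-bounded = All-resp-↭ (↭-sym π↭) (All.applyUpTo⁺₁ suc n id)

  permutation-unique : Unique (toList π)
  permutation-unique = Unique-resp-↭ (≡.setoid ℕ) (↭⇒↭ₛ (↭-sym π↭))
    (Unique.applyUpTo⁺₁ suc n (λ i<j _ → ℕ.<⇒≢ (s<s i<j)))

module _ {A : Set} where

  -- Removes the deduplications in `𝔅[_]` and `_^rc`, so that sums over sets become sums over plain
  -- lists.
  deduplicate-Unique : (_≟_ : DecidableEquality A) {xs : List A} → Unique xs → deduplicate _≟_ xs ≡ xs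
  deduplicate-Unique _≟_ []                  = ≡.refl
  deduplicate-Unique _≟_ {x ∷ xs} (x≢xs ∷ u) = ≡.cong (x ∷_) (≡.trans
    (≡.cong (filter (λ z → ¬? (x ≟ z))) (deduplicate-Unique _≟_ u))
    (List.filter-all (λ z → ¬? (x ≟ z)) x≢xs))

  -- A repetition in the image would survive `g` and reappear in `xs`. The inverse is asked for on
  -- the entries alone because, with truncated subtraction, `rc` undoes itself only on bounded
  -- letters.
  map-Unique : ∀ {B : Set} (f : A → B) (g : B → A) {xs} → All (λ x → g (f x) ≡ x) xs →
               Unique xs → Unique (List.map f xs)
  map-Unique f g {xs} gf u = Unique.map⁻ {f = g} (≡.subst Unique
    (≡.sym (≡.trans (≡.sym (List.map-∘ xs)) (List.map-id-local gf))) u)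

subsets-Unique : ∀ n → Unique (subsets n)
subsets-Unique zero    = [] ∷ []
subsets-Unique (suc n) = Unique.cartesianProductWith⁺ _∷_ Vec.∷-injective
  (((λ ()) ∷ []) ∷ [] ∷ []) (subsets-Unique n)

∣negateAt∣ : ∀ {n} S (π : Vec ℕ n) → Vec.map ℤ.∣_∣ (negateAt S π) ≡ π
∣negateAt∣ []          []      = ≡.refl
∣negateAt∣ (false ∷ S) (a ∷ π) = ≡.cong (a ∷_) (∣negateAt∣ S π)
∣negateAt∣ (true ∷ S)  (a ∷ π) = ≡.cong₂ _∷_ (ℤ.∣-i∣≡∣i∣ (+ a)) (∣negateAt∣ S π)

signs-negateAt : ∀ {n} S (π : Vec ℕ n) → All (0 <_) (toList π) →
                 Vec.map (λ z → does (z ℤ.<? 0ℤ)) (negateAt S π) ≡ S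
signs-negateAt []          []          _          = ≡.refl
signs-negateAt (false ∷ S) (suc a ∷ π) (_ ∷ 0<π) = ≡.cong (false ∷_) (signs-negateAt S π 0<π)
signs-negateAt (true ∷ S)  (suc a ∷ π) (_ ∷ 0<π) = ≡.cong (true ∷_) (signs-negateAt S π 0<π)

𝔅-Unique : ∀ {n} (π : Vec ℕ n) → All (0 <_) (toList π) → Unique (𝔅 π)
𝔅-Unique {n} π 0<π = map-Unique _ (Vec.map (λ z → does (z ℤ.<? 0ℤ)))
  (All.universal (λ S → signs-negateAt S π 0<π) (subsets n)) (subsets-Unique n)

-- Taking absolute values recovers the underlying word.
𝔅-Disjoint : ∀ {n} {π ρ : Vec ℕ n} → π ≢ ρ → Disjoint (𝔅 π) (𝔅 ρ)
𝔅-Disjoint {π = π} {ρ} π≢ρ (σ∈𝔅π , σ∈𝔅ρ) with ∈-map⁻ _ σ∈𝔅π | ∈-map⁻ _ σ∈𝔅ρ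
... | S , _ , σ≡ | S′ , _ , σ≡′ = π≢ρ (≡.trans (≡.sym (∣negateAt∣ S π))
  (≡.trans (≡.cong (Vec.map ℤ.∣_∣) (≡.trans (≡.sym σ≡) σ≡′)) (∣negateAt∣ S′ ρ)))

concatMap-𝔅-Unique : ∀ {n} {Π : List (Vec ℕ n)} → Unique Π → All IsPermutation Π → Unique (concatMap 𝔅 Π)
concatMap-𝔅-Unique unique perms = Unique.concat⁺
  (All.map⁺ (All.map (λ {π} π↭ → 𝔅-Unique π (permutation-positive π π↭)) perms))
  (AllPairs.map⁺ (AllPairs.map 𝔅-Disjoint unique))

rc-rc : ∀ {n} (π : Vec ℕ n) → All (_≤ n) (toList π) → rc (rc π) ≡ π
rc-rc {n} π bounded = begin
  Vec.reverse (Vec.map f (Vec.reverse (Vec.map f π)))  ≡⟨ ≡.cong Vec.reverse (Vec.map-reverse f (Vec.map f π)) ⟩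
  Vec.reverse (Vec.reverse (Vec.map f (Vec.map f π)))  ≡⟨ Vec.reverse-involutive _ ⟩
  Vec.map f (Vec.map f π)                              ≡⟨ map-f-f π bounded ⟩
  π                                                    ∎
  where
  open ≡.≡-Reasoning
  f : ℕ → ℕ
  f a = suc n ∸ a
  map-f-f : ∀ {k} (w : Vec ℕ k) → All (_≤ n) (toList w) → Vec.map f (Vec.map f w) ≡ w
  map-f-f []      []           = ≡.refl
  map-f-f (a ∷ w) (a≤n ∷ w≤n) = ≡.cong₂ _∷_ (ℕ.m∸[m∸n]≡n (ℕ.m≤n⇒m≤1+n a≤n)) (map-f-f w w≤n)

map-rc-Unique : ∀ {n} {Π : List (Vec ℕ n)} → Unique Π → All IsPermutation Π → Unique (List.map rc Π)
map-rc-Unique unique perms =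
  map-Unique rc rc (All.map (λ {π} π↭ → rc-rc π (permutation-bounded π π↭)) perms) unique

-- Finite sums

module Sums (R : CommutativeSemiring 0ℓ 0ℓ) where

  open CommutativeSemiring R
  open import Relation.Binary.Reasoning.Setoid setoid

  sum : {A : Set} → List A → (A → Carrier) → Carrier
  sum xs f = foldr _+_ 0# (List.map f xs)

  module _ {A : Set} where

    sum-cong : ∀ {f g : A → Carrier} {xs} → All (λ x → f x ≈ g x) xs → sum xs f ≈ sum xs g
    sum-cong []       = refl
    sum-cong (e ∷ es) = +-cong e (sum-cong es)

    sum-cong′ : ∀ {f g : A → Carrier} xs → (∀ x → f x ≈ g x) → sum xs f ≈ sum xs g
    sum-cong′ xs e = sum-cong (All.universal e xs)

    sum-++ : ∀ (f : A → Carrier) xs ys → sum (xs ++ ys) f ≈ sum xs f + sum ys f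
    sum-++ f []       ys = sym (+-identityˡ _)
    sum-++ f (x ∷ xs) ys = trans (+-congˡ (sum-++ f xs ys)) (sym (+-assoc _ _ _))

    *-sum : ∀ c (f : A → Carrier) xs → sum xs (λ x → c * f x) ≈ c * sum xs f
    *-sum c f []       = sym (zeroʳ c)
    *-sum c f (x ∷ xs) = trans (+-congˡ (*-sum c f xs)) (sym (distribˡ c _ _))

  sum-map : ∀ {A B : Set} (f : B → Carrier) (g : A → B) xs → sum (List.map g xs) f ≈ sum xs (f ∘ g)
  sum-map f g xs = reflexive (≡.cong (foldr _+_ 0#) (≡.sym (List.map-∘ xs)))

  sum-concatMap : ∀ {A B : Set} (f : B → Carrier) (g : A → List B) xs →
                  sum (concatMap g xs) f ≈ sum xs (λ x → sum (g x) f)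
  sum-concatMap f g []       = refl
  sum-concatMap f g (x ∷ xs) = trans (sum-++ f (g x) _) (+-congˡ (sum-concatMap f g xs))

-- Sums over all choices of signs

module SignedWords (R : CommutativeSemiring 0ℓ 0ℓ) (y t : CommutativeSemiring.Carrier R) where

  open CommutativeSemiring R
  open Exponentiation semiring
  open NaturalSolver R using (solve; _:=_; _:^_; _:+_; _:*_; con)
  open Sums R
  open import Relation.Binary.Reasoning.Setoid setoid

  powIf : Carrier → Bool → Carrier
  powIf x b = if b then x else 1#

  ^-tally : ∀ x p m → x ^ tally p (suc m) ≈ powIf x (p 0) * x ^ tally (p ∘ suc) m
  ^-tally x p m with p 0
  ... | true  = refl
  ... | false = sym (*-identityˡ _)

  -- The comparison of ±a with the next letter ±b is decided by the sign of the
  -- larger of a and b, so t² is attributed to that letter; b < a is the flag d.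
  fromNext fromPrevious : Bool → Bool → Carrier
  fromNext     d s = powIf (t ^ 2) (d ∧ not s)
  fromPrevious d s = powIf (t ^ 2) (not d ∧ s)

  letterFactor : Bool → Bool → Carrier
  letterFactor d d′ = fromPrevious d false * fromNext d′ false
                    + y * (fromPrevious d true * fromNext d′ true)

  letterFactors : (ℕ → Bool) → ℕ → Carrier
  letterFactors d zero    = 1#
  letterFactors d (suc m) = letterFactor (d 0) (d 1) * letterFactors (d ∘ suc) m

  -- The sign of the preceding letter `z` is not weighed here, but its comparison with the first
  -- letter of `τ` is. Every descent counts t²; the flag correction concerns only the first letter
  -- of the full word.
  weight : ∀ {m} → ℤ → Vec ℤ m → Carrier
  weight {m} z τ = y ^ neg τ * (t ^ 2) ^ tally (descentsᴮ z τ) m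

  powIf-split : ∀ d s s′ → powIf (t ^ 2) (if d then not s else s′) ≈ fromNext d s * fromPrevious d s′
  powIf-split true  s s′ = sym (*-identityʳ _)
  powIf-split false s s′ = sym (*-identityˡ _)

  sum-subsets : ∀ m (f : Subset (suc m) → Carrier) →
                sum (subsets (suc m)) f ≈
                sum (subsets m) (λ S → f (false ∷ S)) + sum (subsets m) (λ S → f (true ∷ S))
  sum-subsets m f = begin
    sum (List.map (false ∷_) (subsets m) ++ List.map (true ∷_) (subsets m) ++ []) f
      ≈⟨ sum-++ f (List.map (false ∷_) (subsets m)) _ ⟩
    sum (List.map (false ∷_) (subsets m)) f + sum (List.map (true ∷_) (subsets m) ++ []) f
      ≈⟨ +-cong (sum-map f _ (subsets m))
           (trans (reflexive (≡.cong (λ xs → sum xs f) (List.++-identityʳ (List.map (true ∷_) (subsets m)))))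
             (sum-map f _ (subsets m))) ⟩
    sum (subsets m) (λ S → f (false ∷ S)) + sum (subsets m) (λ S → f (true ∷ S)) ∎

  weight-∷ : ∀ {m a b} s s′ (τ : Vec ℤ m) → 0 < a → 0 < b → a ≢ b →
             weight (signed s a) (signed s′ b ∷ τ) ≈
             powIf y s′ * (fromNext (does (b ℕ.<? a)) s * fromPrevious (does (b ℕ.<? a)) s′)
               * weight (signed s′ b) τ
  weight-∷ {m} {a} {b} s s′ τ 0<a 0<b a≢b = begin
    y ^ neg (signed s′ b ∷ τ) * (t ^ 2) ^ tally (descentsᴮ (signed s a) (signed s′ b ∷ τ)) (suc m)
      ≈⟨ *-cong (neg-∷ s′ 0<b) (^-tally (t ^ 2) (descentsᴮ (signed s a) (signed s′ b ∷ τ)) m) ⟩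
    powIf y s′ * y ^ neg τ * (powIf (t ^ 2) (does (signed s′ b ℤ.<? signed s a)) * T)
      ≈⟨ *-congˡ (*-congʳ (trans (reflexive (≡.cong (powIf (t ^ 2)) (signed-<? s s′ 0<a 0<b a≢b)))
           (powIf-split (does (b ℕ.<? a)) s s′))) ⟩
    powIf y s′ * y ^ neg τ * (fs * T)
      ≈⟨ solve 4 (λ p q r s → p :* q :* (r :* s) := p :* r :* (q :* s)) refl (powIf y s′) (y ^ neg τ) fs T ⟩
    powIf y s′ * fs * (y ^ neg τ * T) ∎
    where
    T fs : Carrier
    T  = (t ^ 2) ^ tally (descentsᴮ (signed s′ b) τ) m
    fs = fromNext (does (b ℕ.<? a)) s * fromPrevious (does (b ℕ.<? a)) s′
    neg-∷ : ∀ {b} s′ → 0 < b → y ^ neg (signed s′ b ∷ τ) ≈ powIf y s′ * y ^ neg τ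
    neg-∷ {suc b} false _ = sym (*-identityˡ _)
    neg-∷ {suc b} true  _ = refl

  -- By `powIf-split` the transfer matrix between the signs of adjacent letters has rank one, so the
  -- sign `s` survives only in a scalar. In the induction that scalar joins the factor of its own
  -- letter, which is why the sum factorises.
  sum-weight : ∀ {m} a s (w : Vec ℕ m) → 0 < a → All (0 <_) (toList w) → Unique (a ∷ toList w) →
               sum (subsets m) (λ S → weight (signed s a) (negateAt S w)) ≈
               fromNext (descents a w 0) s * letterFactors (descents a w) m
  sum-weight a s [] 0<a [] _ = begin
    1# * 1# + 0#            ≈⟨ +-identityʳ _ ⟩
    -- After the last letter `letter` repeats `a`, and a is not below itself, so `fromNext` is 1.
    1# * 1#                 ≡⟨ ≡.cong (λ d → fromNext d s * 1#) (dec-false (a ℕ.<? a) (ℕ.<-irrefl ≡.refl)) ⟨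
    fromNext (does (a ℕ.<? a)) s * 1#  ∎
  sum-weight {suc m} a s (b ∷ w) 0<a (0<b ∷ 0<w) ((a≢b ∷ _) ∷ unique) = begin
    sum (subsets (suc m)) (λ S → weight (signed s a) (negateAt S (b ∷ w)))
      ≈⟨ sum-subsets m _ ⟩
    sum (subsets m) (λ S → weight (signed s a) (signed false b ∷ negateAt S w)) +
    sum (subsets m) (λ S → weight (signed s a) (signed true b ∷ negateAt S w))
      ≈⟨ +-cong (half false) (half true) ⟩
    1# * (fn * fromPrevious d false) * (fromNext d′ false * W) +
    y * (fn * fromPrevious d true) * (fromNext d′ true * W)
      ≈⟨ solve 7 (λ y fn p₀ p₁ n₀ n₁ W →
           con 1 :* (fn :* p₀) :* (n₀ :* W) :+ y :* (fn :* p₁) :* (n₁ :* W) :=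
           fn :* ((p₀ :* n₀ :+ y :* (p₁ :* n₁)) :* W))
           refl y fn (fromPrevious d false) (fromPrevious d true) (fromNext d′ false) (fromNext d′ true) W ⟩
    fn * (letterFactor d d′ * W) ∎
    where
    d d′ : Bool
    d  = does (b ℕ.<? a)
    d′ = descents b w 0
    fn W : Carrier
    fn = fromNext d s
    W  = letterFactors (descents b w) m
    half : ∀ s′ → sum (subsets m) (λ S → weight (signed s a) (signed s′ b ∷ negateAt S w)) ≈
                  powIf y s′ * (fn * fromPrevious d s′) * (fromNext d′ s′ * W)
    half s′ = begin
      sum (subsets m) (λ S → weight (signed s a) (signed s′ b ∷ negateAt S w))
        ≈⟨ sum-cong′ (subsets m) (λ S → weight-∷ s s′ (negateAt S w) 0<a 0<b a≢b) ⟩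
      sum (subsets m) (λ S → powIf y s′ * (fn * fromPrevious d s′) * weight (signed s′ b) (negateAt S w))
        ≈⟨ *-sum _ _ (subsets m) ⟩
      powIf y s′ * (fn * fromPrevious d s′) * sum (subsets m) (λ S → weight (signed s′ b) (negateAt S w))
        ≈⟨ *-congˡ (sum-weight b s′ w 0<b 0<w unique) ⟩
      powIf y s′ * (fn * fromPrevious d s′) * (fromNext d′ s′ * W) ∎

  -- A negative first letter creates a descent at position 0; the flag correction reduces its t² to
  -- t.
  y^neg*t^fdes : ∀ {m a} s (τ : Vec ℤ m) → 0 < a →
                 y ^ neg (signed s a ∷ τ) * t ^ fdes (signed s a ∷ τ) ≈
                 (if s then y * t else 1#) * weight (signed s a) τ
  y^neg*t^fdes {m} {suc a} false τ _ = begin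
    y ^ neg τ * t ^ (2 ℕ.* desᴮ σ)
      ≡⟨ ≡.cong (λ k → y ^ neg τ * t ^ (2 ℕ.* k)) (count-applyUpTo (descentᴮ? σ) id (suc m)) ⟩
    y ^ neg τ * t ^ (2 ℕ.* k)
      ≈⟨ *-congˡ (^-assocʳ t 2 k) ⟨
    y ^ neg τ * (t ^ 2) ^ k
      ≈⟨ *-identityˡ _ ⟨
    1# * (y ^ neg τ * (t ^ 2) ^ k) ∎
    where
    σ = + suc a ∷ τ
    k = tally (descentsᴮ (+ suc a) τ) m
  y^neg*t^fdes {m} {suc a} true τ _ = begin
    y * y ^ neg τ * t ^ (2 ℕ.* desᴮ σ ∸ 1)
      ≡⟨ ≡.cong (λ k → y * y ^ neg τ * t ^ (2 ℕ.* k ∸ 1)) (count-applyUpTo (descentᴮ? σ) id (suc m)) ⟩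
    -- Here `desᴮ σ` is k + 1, so the subtraction in 2(k + 1) - 1 is not truncated.
    y * y ^ neg τ * t ^ (k ℕ.+ suc (k ℕ.+ 0))
      ≡⟨ ≡.cong (λ k → y * y ^ neg τ * t ^ k) (ℕ.+-suc k (k ℕ.+ 0)) ⟩
    y * y ^ neg τ * (t * t ^ (2 ℕ.* k))
      ≈⟨ *-congˡ (*-congˡ (^-assocʳ t 2 k)) ⟨
    y * y ^ neg τ * (t * (t ^ 2) ^ k)
      ≈⟨ solve 4 (λ y p t q → y :* p :* (t :* q) := y :* t :* (p :* q)) refl y (y ^ neg τ) t ((t ^ 2) ^ k) ⟩
    y * t * (y ^ neg τ * (t ^ 2) ^ k) ∎
    where
    σ = ℤ.-[1+ a ] ∷ τ
    k = tally (descentsᴮ ℤ.-[1+ a ] τ) m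

  sum-𝔅 : ∀ {m} a (w : Vec ℕ m) → 0 < a → All (0 <_) (toList w) → Unique (a ∷ toList w) →
          sum (𝔅 (a ∷ w)) (λ σ → y ^ neg σ * t ^ fdes σ) ≈
          (powIf (t ^ 2) (descents a w 0) + y * t) * letterFactors (descents a w) m
  sum-𝔅 {m} a w 0<a 0<w unique = begin
    sum (𝔅 (a ∷ w)) f
      ≈⟨ sum-map f _ (subsets (suc m)) ⟩
    sum (subsets (suc m)) (λ S → f (negateAt S (a ∷ w)))
      ≈⟨ sum-subsets m _ ⟩
    sum (subsets m) (λ S → f (signed false a ∷ negateAt S w)) +
    sum (subsets m) (λ S → f (signed true a ∷ negateAt S w))
      ≈⟨ +-cong (half false) (half true) ⟩
    1# * (fromNext d false * W) + y * t * (fromNext d true * W)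
      ≡⟨ ≡.cong₂ (λ b b′ → 1# * (powIf (t ^ 2) b * W) + y * t * (powIf (t ^ 2) b′ * W))
           (∧-identityʳ d) (∧-zeroʳ d) ⟩
    1# * (powIf (t ^ 2) d * W) + y * t * (1# * W)
      ≈⟨ solve 3 (λ n yt W → con 1 :* (n :* W) :+ yt :* (con 1 :* W) := (n :+ yt) :* W)
           refl (powIf (t ^ 2) d) (y * t) W ⟩
    (powIf (t ^ 2) d + y * t) * W ∎
    where
    f : Vec ℤ (suc m) → Carrier
    f σ = y ^ neg σ * t ^ fdes σ
    d : Bool
    d = descents a w 0
    W : Carrier
    W = letterFactors (descents a w) m
    half : ∀ s → sum (subsets m) (λ S → f (signed s a ∷ negateAt S w)) ≈
                 (if s then y * t else 1#) * (fromNext d s * W)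
    half s = begin
      sum (subsets m) (λ S → f (signed s a ∷ negateAt S w))
        ≈⟨ sum-cong′ (subsets m) (λ S → y^neg*t^fdes s (negateAt S w) 0<a) ⟩
      sum (subsets m) (λ S → (if s then y * t else 1#) * weight (signed s a) (negateAt S w))
        ≈⟨ *-sum _ _ (subsets m) ⟩
      (if s then y * t else 1#) * sum (subsets m) (λ S → weight (signed s a) (negateAt S w))
        ≈⟨ *-congˡ (sum-weight a s w 0<a 0<w unique) ⟩
      (if s then y * t else 1#) * (fromNext d s * W) ∎

  -- Matching the product with the monomial

  -- `C`, `D` and `E` are the factors of a valley, a double ascent and a double descent. The first
  -- letter contributes `A` before an ascent and t times `B` before a descent.
  A B C D E : Carrier
  A = 1# + y * t
  B = y + t
  C = 1# + y
  D = 1# + y * t ^ 2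
  E = y + t ^ 2

  -- Equations cleared of denominators stand in for the fractions. Z is constrained through YZ
  -- because each peak is followed by its own valley.
  module _ {Y Z T : Carrier} (Y-eq : Y * (E * A) ≈ t * C * B) (T-eq : T * D ≈ E)
           (YZ-eq : Y * Z * (E * D) ≈ t * C * (t * C)) where

    -- The shift in the exponent of `T` leaves the descent `d 0` to the first letter, see
    -- `Balanced-start`.
    statistics : (ℕ → Bool) → ℕ → Carrier
    statistics d m = Y ^ tally (valleys d) m
                   * Z ^ tally (peaks d) m
                   * T ^ tally (d ∘ suc) m

    -- x is the product of the letter factors and q the matching part of the
    -- right-hand side up to some position; an open descent (d = true) has not
    -- yet contributed its factors C and D Y.
    Balanced : Bool → Carrier → Carrier → Set
    Balanced d x q = if d then x * C ≈ q * (D * Y) else x ≈ q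

    statisticsFactor : Bool → Bool → Carrier
    statisticsFactor d d′ = powIf Y (d ∧ not d′) * powIf Z (not d ∧ d′) * powIf T d′

    -- A double ascent gives D on both sides, and a double descent E = TD with the debt unchanged. A
    -- peak opens a debt: t²C times the pending C is t²C², matched by `YZ-eq`. The valley pays it
    -- off.
    Balanced-step : ∀ d d′ {x q} → Balanced d x q →
                    Balanced d′ (x * letterFactor d d′) (q * (D * statisticsFactor d d′))
    Balanced-step false false {x} {q} x≈q = begin
      x * (1# * 1# + y * (t ^ 2 * 1#))
        ≈⟨ solve 3 (λ x y s → x :* (con 1 :* con 1 :+ y :* (s :* con 1)) :=
                              x :* ((con 1 :+ y :* s) :* (con 1 :* con 1 :* con 1))) refl x y (t ^ 2) ⟩
      x * (D * (1# * 1# * 1#))  ≈⟨ *-congʳ x≈q ⟩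
      q * (D * (1# * 1# * 1#))  ∎
    Balanced-step false true {x} {q} x≈q = begin
      x * (1# * t ^ 2 + y * (t ^ 2 * 1#)) * C
        ≈⟨ solve 3 (λ x y t → x :* (con 1 :* t :^ 2 :+ y :* (t :^ 2 :* con 1)) :* (con 1 :+ y) :=
                              x :* (t :* (con 1 :+ y) :* (t :* (con 1 :+ y)))) refl x y t ⟩
      x * (t * C * (t * C))
        ≈⟨ *-cong x≈q (sym YZ-eq) ⟩
      q * (Y * Z * (E * D))
        ≈⟨ *-congˡ (*-congˡ (*-congʳ T-eq)) ⟨
      q * (Y * Z * (T * D * D))
        ≈⟨ solve 5 (λ q Y Z T D → q :* (Y :* Z :* (T :* D :* D)) :=
                                  q :* (D :* (con 1 :* Z :* T)) :* (D :* Y)) refl q Y Z T D ⟩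
      q * (D * (1# * Z * T)) * (D * Y) ∎
    Balanced-step true false {x} {q} xC≈qDY = begin
      x * (1# * 1# + y * (1# * 1#))
        ≈⟨ solve 2 (λ x y → x :* (con 1 :* con 1 :+ y :* (con 1 :* con 1)) := x :* (con 1 :+ y)) refl x y ⟩
      x * C
        ≈⟨ xC≈qDY ⟩
      q * (D * Y)
        ≈⟨ solve 3 (λ q D Y → q :* (D :* Y) := q :* (D :* (Y :* con 1 :* con 1))) refl q D Y ⟩
      q * (D * (Y * 1# * 1#)) ∎
    Balanced-step true true {x} {q} xC≈qDY = begin
      x * (1# * t ^ 2 + y * (1# * 1#)) * C
        ≈⟨ solve 4 (λ x y s C → x :* (con 1 :* s :+ y :* (con 1 :* con 1)) :* C :=
                                x :* C :* (y :+ s)) refl x y (t ^ 2) C ⟩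
      x * C * E
        ≈⟨ *-cong xC≈qDY (sym T-eq) ⟩
      q * (D * Y) * (T * D)
        ≈⟨ solve 4 (λ q Y T D → q :* (D :* Y) :* (T :* D) :=
                                q :* (D :* (con 1 :* con 1 :* T)) :* (D :* Y)) refl q Y T D ⟩
      q * (D * (1# * 1# * T)) * (D * Y) ∎

    statistics-suc : ∀ d m → statistics d (suc m) ≈ statisticsFactor (d 0) (d 1) * statistics (d ∘ suc) m
    statistics-suc d m = begin
      statistics d (suc m)
        ≈⟨ *-cong (*-cong (^-tally Y (valleys d) m) (^-tally Z (peaks d) m)) (^-tally T (d ∘ suc) m) ⟩
      pY * qY * (pZ * qZ) * (pT * qT)
        ≈⟨ solve 6 (λ pY qY pZ qZ pT qT → pY :* qY :* (pZ :* qZ) :* (pT :* qT) :=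
                                          pY :* pZ :* pT :* (qY :* qZ :* qT)) refl pY qY pZ qZ pT qT ⟩
      pY * pZ * pT * (qY * qZ * qT) ∎
      where
      pY pZ pT qY qZ qT : Carrier
      pY = powIf Y (d 0 ∧ not (d 1))
      pZ = powIf Z (not (d 0) ∧ d 1)
      pT = powIf T (d 1)
      qY = Y ^ tally (valleys (d ∘ suc)) m
      qZ = Z ^ tally (peaks (d ∘ suc)) m
      qT = T ^ tally (d ∘ suc ∘ suc) m

    -- The accumulators `x` and `q` let the induction run from the left. As `d m` is false, no
    -- descent is open at the end, where the balance is a plain equality.
    letterFactors≈statistics : ∀ d m {x q} → d m ≡ false → Balanced (d 0) x q →
                               x * letterFactors d m ≈ q * (D ^ m * statistics d m)
    letterFactors≈statistics d zero {x} {q} d₀ x∼q rewrite d₀ = begin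
      x * 1#                       ≈⟨ *-congʳ x∼q ⟩
      q * 1#                       ≈⟨ solve 1 (λ q → q :* con 1 := q :* (con 1 :* (con 1 :* con 1 :* con 1))) refl q ⟩
      q * (1# * (1# * 1# * 1#))    ∎
    letterFactors≈statistics d (suc m) {x} {q} dₘ x∼q = begin
      x * (letterFactor (d 0) (d 1) * letterFactors (d ∘ suc) m)
        ≈⟨ *-assoc _ _ _ ⟨
      x * letterFactor (d 0) (d 1) * letterFactors (d ∘ suc) m
        ≈⟨ letterFactors≈statistics (d ∘ suc) m dₘ (Balanced-step (d 0) (d 1) x∼q) ⟩
      q * (D * sf) * (D ^ m * S)
        ≈⟨ solve 5 (λ q D sf Dᵐ S → q :* (D :* sf) :* (Dᵐ :* S) := q :* (D :* Dᵐ :* (sf :* S)))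
             refl q D sf (D ^ m) S ⟩
      q * (D * D ^ m * (sf * S))
        ≈⟨ *-congˡ (*-congˡ (statistics-suc d m)) ⟨
      q * (D * D ^ m * statistics d (suc m)) ∎
      where
      sf S : Carrier
      sf = statisticsFactor (d 0) (d 1)
      S  = statistics (d ∘ suc) m

    -- An initial descent opens a debt without a peak, and this is where the value of `Y` alone is
    -- used.
    Balanced-start : ∀ d → Balanced d (powIf (t ^ 2) d + y * t) (A * powIf T d)
    Balanced-start false = sym (*-identityʳ _)
    Balanced-start true  = begin
      (t ^ 2 + y * t) * C
        ≈⟨ solve 2 (λ y t → (t :^ 2 :+ y :* t) :* (con 1 :+ y) := t :* (con 1 :+ y) :* (y :+ t)) refl y t ⟩
      t * C * B
        ≈⟨ Y-eq ⟨
      Y * (E * A)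
        ≈⟨ *-congˡ (*-congʳ T-eq) ⟨
      Y * (T * D * A)
        ≈⟨ solve 4 (λ Y T D A → Y :* (T :* D :* A) := A :* T :* (D :* Y)) refl Y T D A ⟩
      A * T * (D * Y) ∎

    sum-𝔅-rc : ∀ {m} (π : Vec ℕ (suc m)) → IsPermutation π →
               sum (𝔅 π) (λ σ → y ^ neg σ * t ^ fdes σ) ≈
               A * D ^ m * (Y ^ lpk (rc π) * Z ^ val (rc π) * T ^ des (rc π))
    sum-𝔅-rc {m} π@(a ∷ w) π↭ = begin
      sum (𝔅 π) (λ σ → y ^ neg σ * t ^ fdes σ)
        ≈⟨ sum-𝔅 a w (All.head 0<π) (All.tail 0<π) unique ⟩
      (powIf (t ^ 2) (d 0) + y * t) * letterFactors d m
        ≈⟨ letterFactors≈statistics d m (descents-last a w) (Balanced-start (d 0)) ⟩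
      A * powIf T (d 0) * (D ^ m * (V * T ^ tally (d ∘ suc) m))
        ≈⟨ solve 5 (λ A T₀ Dᵐ V Tᵐ → A :* T₀ :* (Dᵐ :* (V :* Tᵐ)) := A :* Dᵐ :* (V :* (T₀ :* Tᵐ)))
             refl A (powIf T (d 0)) (D ^ m) V (T ^ tally (d ∘ suc) m) ⟩
      A * D ^ m * (V * (powIf T (d 0) * T ^ tally (d ∘ suc) m))
        ≈⟨ *-congˡ (*-congˡ (^-tally T d m)) ⟨
      A * D ^ m * (V * T ^ tally d (suc m))
        ≡⟨ ≡.cong₂ (λ i j → A * D ^ m * (i * j))
             (≡.cong₂ (λ i j → Y ^ i * Z ^ j) (lpk-rc unique bounded) (val-rc unique bounded))
             (≡.cong (T ^_) (des-rc unique bounded)) ⟨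
      A * D ^ m * (Y ^ lpk (rc π) * Z ^ val (rc π) * T ^ des (rc π)) ∎
      where
      0<π     = permutation-positive π π↭
      unique  = permutation-unique π π↭
      bounded = permutation-bounded π π↭
      d : ℕ → Bool
      d = descents a w
      V : Carrier
      V = Y ^ tally (valleys d) m * Z ^ tally (peaks d) m

    sum-𝔅[]-rc : ∀ {m} (Π : List (Vec ℕ (suc m))) → Unique Π → All IsPermutation Π →
                 sum 𝔅[ Π ] (λ σ → y ^ neg σ * t ^ fdes σ) ≈
                 A * D ^ m * sum (Π ^rc) (λ π → Y ^ lpk π * Z ^ val π * T ^ des π)
    sum-𝔅[]-rc {m} Π uniqueΠ perms = begin
      sum 𝔅[ Π ] f
        ≡⟨ ≡.cong (λ xs → sum xs f) (deduplicate-Unique _ (concatMap-𝔅-Unique uniqueΠ perms)) ⟩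
      sum (concatMap 𝔅 Π) f
        ≈⟨ sum-concatMap f 𝔅 Π ⟩
      sum Π (λ π → sum (𝔅 π) f)
        ≈⟨ sum-cong (All.map (λ {π} → sum-𝔅-rc π) perms) ⟩
      sum Π (λ π → A * D ^ m * g (rc π))
        ≈⟨ *-sum (A * D ^ m) (g ∘ rc) Π ⟩
      A * D ^ m * sum Π (g ∘ rc)
        ≈⟨ *-congˡ (sum-map g rc Π) ⟨
      A * D ^ m * sum (List.map rc Π) g
        ≡⟨ ≡.cong (λ xs → A * D ^ m * sum xs g) (deduplicate-Unique _ (map-rc-Unique uniqueΠ perms)) ⟨
      A * D ^ m * sum (Π ^rc) g ∎
      where
      f : Vec ℤ (suc m) → Carrier
      f σ = y ^ neg σ * t ^ fdes σ
      g : Vec ℕ (suc m) → Carrier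
      g π = Y ^ lpk π * Z ^ val π * T ^ des π

-- Specialisation to rational functions

open import Defs

private
  module Kₚ = FractionProperties ℤ[y][t].domain
  module Kₛ = CommutativeSemiring Kₚ.commutativeSemiring-≃
  module D = Domain ℤ[y][t].domain

-- With arbitrary fractions for `y` and `t`, the argument never unfolds concrete polynomials.
-- Nonvanishing of the divisors is assumed here and found by computation at the indeterminates.
F≈P : ∀ y t {nz₁ nz₂ nz₃} {m} (Π : List (Vec ℕ (suc m))) → Unique Π → All IsPermutation Π →
      F Π y t ≈
      (1# + y * t) * (1# + y * t ^ 2) ^ m *
      P (Π ^rc)
        (_÷_ (t * (1# + y) * (y + t)) ((y + t ^ 2) * (1# + y * t)) {nz₁})
        (_÷_ (t * (1# + y) * (1# + y * t)) ((1# + y * t ^ 2) * (y + t)) {nz₂})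
        (_÷_ (y + t ^ 2) (1# + y * t ^ 2) {nz₃})
F≈P y t {nz₁} {nz₂} {nz₃} = sum-𝔅[]-rc {Y} {Z} {T} Y-eq T-eq YZ-eq
  where
  open SignedWords Kₚ.commutativeSemiring-≃ y t
  open NaturalSolver Kₚ.commutativeSemiring-≃ using (solve; _:=_; _:*_)
  open import Relation.Binary.Reasoning.Setoid Kₛ.setoid
  tC Y Z T : ℚ⟨y,t⟩
  tC = t * C
  Y = _÷_ (tC * B) (E * A) {nz₁}
  Z = _÷_ (tC * A) (D * B) {nz₂}
  T = _÷_ E D {nz₃}
  Y-eq : Y * (E * A) ≈ tC * B
  Y-eq = Kₚ.÷-* (tC * B) (E * A) {nz₁}
  Z-eq : Z * (D * B) ≈ tC * A
  Z-eq = Kₚ.÷-* (tC * A) (D * B) {nz₂}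
  T-eq : T * D ≈ E
  T-eq = Kₚ.÷-* E D {nz₃}
  AB≉0 : ¬ K.num (A * B) D.≈ D.0#
  AB≉0 = Kₚ.num-*-≉0 A B (Kₚ.num-*ʳ-≉0 E A (toWitnessFalse nz₁)) (Kₚ.num-*ʳ-≉0 D B (toWitnessFalse nz₂))
  YZ-eq : Y * Z * (E * D) ≈ tC * tC
  -- Y is a multiple of B/A and Z of A/B, so the product identity holds after cancelling AB, which
  -- is nonzero because A and B divide the given denominators.
  YZ-eq = Kₚ.*-cancelʳ-≃ {Y * Z * (E * D)} {tC * tC} (A * B) AB≉0 (begin
    Y * Z * (E * D) * (A * B)
      ≈⟨ solve 6 (λ Y Z A B D E → Y :* Z :* (E :* D) :* (A :* B) := Y :* (E :* A) :* (Z :* (D :* B)))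
           Kₛ.refl Y Z A B D E ⟩
    Y * (E * A) * (Z * (D * B))
      ≈⟨ Kₛ.*-cong Y-eq Z-eq ⟩
    tC * B * (tC * A)
      ≈⟨ solve 3 (λ tC A B → tC :* B :* (tC :* A) := tC :* tC :* (A :* B)) Kₛ.refl tC A B ⟩
    tC * tC * (A * B) ∎)

theorem5p15 : (n : ℕ) → 1 ≤ n →
    (Π : List (Vec ℕ n)) → Unique Π → All IsPermutation Π →
    F Π y t ≈
    (1# + y * t) * (1# + y * t ^ 2) ^ (n ∸ 1) *
    P (Π ^rc)
    ((t * (1# + y) * (y + t)) ÷ ((y + t ^ 2) * (1# + y * t)))
    ((t * (1# + y) * (1# + y * t)) ÷ ((1# + y * t ^ 2) * (y + t)))
    ((y + t ^ 2) ÷ (1# + y * t ^ 2))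
theorem5p15 (suc m) _ = F≈P y t
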